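{- Let $(\mathbb A,\mathbb B)$ be a PCSP template, let $\mathcal R$ be a relaxation (i.e. a minion) that does not accept all instances, i.e. not every LC instance has a solution in $\mathcal R$, let $\mathcal I$ be an instance of $\mathrm{PCSP}(\mathbb A,\mathbb B)$, and let $k\in\mathbb N$. (1) If $\mathrm{lc}_{\mathbb A}^{nk}(\mathcal I)$ has a solution in $\mathcal R$, then so does $\mathrm{pow}_k\,\mathrm{lc}_{\mathbb A}(\mathcal I)$, where $n$ is the maximal arity of the relations in $\mathbb A$. (2) If $\mathrm{pow}_{k+1}\,\mathrm{lc}_{\mathbb A}(\mathcal I)$ has a solution in $\mathcal R$, then so does $\mathrm{lc}_{\mathbb A}^{k}(\mathcal I)$.
   Context: An LC (label cover) instance $\mathcal D$ consists of a finite set $X$ of variables, a finite set $\mathcal D_x$ (domain) for each $x\in X$, and a finite list of constraints of the form $x=\alpha(y)$ with $x,y\in X$ and $\alpha:\mathcal D_y\to\mathcal D_x$ a function. A minion $\mathcal R$ is a functor from finite sets to sets: it assigns a set $\mathcal R^{(D)}$ to each finite set $D$ and a map $\mathcal R^{(\alpha)}:\mathcal R^{(D)}\to\mathcal R^{(E)}$ to each function $\alpha:D\to E$ between finite sets, preserving identities and composition. A solution of $\mathcal D$ in $\mathcal R$ is a tuple $(r_x)_{x\in X}$ with $r_x\in\mathcal R^{(\mathcal D_x)}$ and $r_x=\mathcal R^{(\alpha)}(r_y)$ for every constraint $x=\alpha(y)$ of $\mathcal D$. A structure $\mathbb A$ in a signature $\Sigma$ (a set of relation symbols $R$ with arities $\mathrm{ar}(R)\in\mathbb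 N$) consists of a finite set $A$ and a relation $R^{\mathbb A}\subseteq A^{\mathrm{ar}(R)}$ for each $R\in\Sigma$. A PCSP template is a pair $(\mathbb A,\mathbb B)$ of structures in the same finite signature such that there is a homomorphism (relation-preserving map) $\mathbb A\to\mathbb B$. An instance $\mathcal I$ of $\mathrm{PCSP}(\mathbb A,\mathbb B)$ is a list of formal constraints $x_1\dots x_n\in R$ with $R\in\Sigma$, $n=\mathrm{ar}(R)$, and $x_i$ variables. The LC instance $\mathrm{lc}_{\mathbb A}(\mathcal I)$ has as variables the variables of $\mathcal I$, each with domain $A$, together with one variable $y$ with domain $R^{\mathbb A}$ for each constraint $x_1\dots x_n\in R$ of $\mathcal I$, with LC constraints $x_i=\pi_i(y)$, $i=1,\dots,n$, where $\pi_i$ is the $i$-th projection. For $m\in\mathbb N$, the LC instance $\mathrm{lc}_{\mathbb A}^m(\mathcal I)$ has as variables the sets $U$ of at most $m$ variables of $\mathcal I$; the domain of $U$ is the set of partial solutions on $U$, i.e. functions $f:U\to A$ satisfying $f(x_1)\dots f(x_n)\in R^{\mathbb A}$ for every constraint $x_1\dots x_n\in R$ of $\mathcal I$ with all $x_i\in U$; and for every inclusion $U\subseteq U'$ there is the constraint $U=\mathrm{res}(U')$, where $\mathrm{res}(f)=f|_U$. The $k$-th saturated power $\mathrm{pow}_k\,\mathcal D$ of an LC instance $\mathcal D$ with variable set $X$ is the LC instance with variable set $X^k$, domains $\mathcal D_{x_1x_2\dots x_k}=\mathcal D_{x_1}\times\cdots\times\mathcal D_{x_k}$, and the following constraints, where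 first all constraints $x=\mathrm{id}(x)$ ($x\in X$) are added to $\mathcal D$: (1) for every $k$-tuple of constraints $x_i=\alpha_i(y_i)$, $i=1,\dots,k$, of $\mathcal D$, the constraint $x_1\dots x_k=(\alpha_1\times\cdots\times\alpha_k)(y_1\dots y_k)$; (2) for every $x_1\dots x_k\in X^k$ and every function $\sigma:[k]\to[k]$, the constraint $x_{\sigma(1)}\dots x_{\sigma(k)}=\sigma^*(x_1\dots x_k)$, where $\sigma^*(d_1\dots d_k)=d_{\sigma(1)}\dots d_{\sigma(k)}$.
   Formalization: Part (2) additionally assumes that not every LC instance with nonempty domains has a solution in R and, if the instance I has no constraints, that R is not constantly empty; as stated, (2) fails without these. -}

module Defs where

open import Data.Bool using (Bool; true; false; T; T?)
open import Data.Bool.Properties using (T-irrelevant)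
open import Data.Fin using (Fin; zero; suc)
open import Data.Fin.Properties using (+↔⊎; 0↔⊥; 1↔⊤; 2↔Bool)
open import Data.Fin.Subset using (Subset; inside; outside; _∈_; _⊆_; ∣_∣)
open import Data.Fin.Subset.Properties using (_∈?_; _⊆?_)
open import Data.Irrelevant using ([_])
open import Data.List as List using (List; length)
import Data.List.Relation.Unary.All as ListAll
import Data.List.Relation.Unary.Any as ListAny
open import Data.Nat using (ℕ; zero; suc; _+_; _≤_; _≤?_; _⊔_)
open import Data.Product using (Σ; Σ-syntax; _×_; _,_; proj₁; proj₂)
open import Data.Product.Function.Dependent.Propositional using (Σ-↔)
open import Data.Refinement using (Refinement-syntax; value; _,_)
open import Data.Sum using (_⊎_; inj₁; inj₂)
open import Data.Sum.Function.Propositional using (_⊎-↔_)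
open import Data.Vec as Vec using (Vec; []; _∷_; lookup; tabulate)
open import Data.Vec.Properties using (lookup∘tabulate)
open import Data.Vec.Properties.WithK using ([]=-irrelevant)
open import Data.Vec.Membership.Propositional using () renaming (_∈_ to _∈ᵛ_)
open import Data.Vec.Relation.Unary.All as All using (All; []; _∷_)
open import Data.Vec.Relation.Unary.All.Properties using (gmap; map⁺; map⁻; lookup⁺)
open import Function using (_∘_; id)
open import Function.Bundles using (_↔_; mk↔ₛ′; Func; module Inverse)
open import Function.Construct.Composition using (_↔-∘_)
open import Function.Construct.Identity using (↔-id)
open import Function.Construct.Symmetry using (↔-sym)
open import Level using (Level; 0ℓ) renaming (suc to lsuc; _⊔_ to _⊔ℓ_)
open import Relation.Binary using (Setoid)
open import Relation.Binary.PropositionalEquality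
  as ≡ using (_≡_; _≗_; refl; cong; cong₂; subst)
open import Relation.Nullary using (Dec; yes; no; recompute; contradiction)
open import Relation.Nullary.Decidable using (⌊_⌋; toWitness; fromWitness; map′)
open import Relation.Unary using (Pred; Decidable)

------------------------------------------------------------------------
-- Finite sets

Finite : Set → Set
Finite X = Σ[ n ∈ ℕ ] (X ↔ Fin n)

record FinSet : Set₁ where
  constructor finSet
  field
    Carrier : Set
    finite  : Finite Carrier

  size : ℕ
  size = proj₁ finite

  enum : Fin size → Carrier
  enum = Inverse.from (proj₂ finite)

open FinSet public using () renaming (Carrier to ⟨_⟩)

private
  variable
    X Y : Set
    m n : ℕ

transport : X ↔ Y → Finite Y → Finite X
transport X↔Y (n , Y↔Fin) = n , (Y↔Fin ↔-∘ X↔Y)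

finite-Fin : ∀ n → Finite (Fin n)
finite-Fin n = n , ↔-id _

finite-⊎ : Finite X → Finite Y → Finite (X ⊎ Y)
finite-⊎ (m , f) (n , g) = m + n , (↔-sym +↔⊎ ↔-∘ (f ⊎-↔ g))

private
  Σ-Fin-suc : (B : Fin (suc n) → Set) →
              Σ (Fin (suc n)) B ↔ (B zero ⊎ Σ (Fin n) (B ∘ suc))
  Σ-Fin-suc B = mk↔ₛ′
    (λ { (zero , b) → inj₁ b ; (suc i , b) → inj₂ (i , b) })
    (λ { (inj₁ b) → zero , b ; (inj₂ (i , b)) → suc i , b })
    (λ { (inj₁ b) → refl ; (inj₂ (i , b)) → refl })
    (λ { (zero , b) → refl ; (suc i , b) → refl })

  finite-ΣFin : ∀ n {B : Fin n → Set} → (∀ i → Finite (B i)) → Finite (Σ (Fin n) B)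
  finite-ΣFin zero    fB = 0 , mk↔ₛ′ proj₁ (λ ()) (λ ()) (λ { (() , _) })
  finite-ΣFin (suc n) {B} fB =
    transport (Σ-Fin-suc B) (finite-⊎ (fB zero) (finite-ΣFin n (fB ∘ suc)))

finite-Σ : {B : X → Set} → Finite X → (∀ x → Finite (B x)) → Finite (Σ X B)
finite-Σ {B = B} (n , f) fB =
  transport (↔-sym (Σ-↔ {A = λ i → B (Inverse.from f i)} {B = B} (↔-sym f) (↔-id _)))
            (finite-ΣFin n (fB ∘ Inverse.from f))

finite-× : Finite X → Finite Y → Finite (X × Y)
finite-× fX fY = finite-Σ fX (λ _ → fY)

finite-Bool : Finite Bool
finite-Bool = 2 , ↔-sym 2↔Bool

finite-All : {D : X → Set} → (∀ x → Finite (D x)) → (xs : Vec X n) → Finite (All D xs)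
finite-All fD []       = 1 , mk↔ₛ′ (λ _ → zero) (λ _ → []) (λ { zero → refl }) (λ { [] → refl })
finite-All fD (x ∷ xs) = transport
  (mk↔ₛ′ All.uncons (λ (p , ps) → p ∷ ps) (λ _ → refl) (λ { (_ ∷ _) → refl }))
  (finite-× (fD x) (finite-All fD xs))

finite-Vec : Finite X → ∀ n → Finite (Vec X n)
finite-Vec fX zero    = 1 , mk↔ₛ′ (λ _ → zero) (λ _ → []) (λ { zero → refl }) (λ { [] → refl })
finite-Vec fX (suc n) = transport
  (mk↔ₛ′ Vec.uncons (λ (x , xs) → x ∷ xs) (λ _ → refl) (λ { (_ ∷ _) → refl }))
  (finite-× fX (finite-Vec fX n))

private
  finite-T : ∀ b → Finite (T b)
  finite-T true  = 1 , ↔-sym 1↔⊤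
  finite-T false = 0 , ↔-sym 0↔⊥

finite-Refinement : {P : Pred X 0ℓ} → Finite X → Decidable P → Finite [ x ∈ X ∣ P x ]
finite-Refinement {P = P} fX P? = transport
  (mk↔ₛ′ (λ { (x , [ p ]) → x , recompute (T? _) (fromWitness {a? = P? x} p) })
         (λ (x , t) → x , [ toWitness t ])
         (λ (x , t) → cong (x ,_) (T-irrelevant _ t))
         (λ _ → refl))
  (finite-Σ fX (λ x → finite-T ⌊ P? x ⌋))

FinType : ℕ → FinSet
FinType n = finSet (Fin n) (finite-Fin n)

infixl 6 _+ᶠ_
_+ᶠ_ : FinSet → FinSet → FinSet
finSet X fX +ᶠ finSet Y fY = finSet (X ⊎ Y) (finite-⊎ fX fY)

infixl 7 _×ᶠ_
_×ᶠ_ : FinSet → FinSet → FinSet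
finSet X fX ×ᶠ finSet Y fY = finSet (X × Y) (finite-× fX fY)

Σᶠ : (X : FinSet) → (⟨ X ⟩ → FinSet) → FinSet
Σᶠ X D = finSet (Σ ⟨ X ⟩ (⟨_⟩ ∘ D)) (finite-Σ (FinSet.finite X) (FinSet.finite ∘ D))

infixl 8 _^ᶠ_
_^ᶠ_ : FinSet → ℕ → FinSet
finSet X fX ^ᶠ n = finSet (Vec X n) (finite-Vec fX n)

-- The product D x₁ × ⋯ × D xₙ.
Πᶠ : (X → FinSet) → Vec X n → FinSet
Πᶠ D xs = finSet (All (⟨_⟩ ∘ D) xs) (finite-All (FinSet.finite ∘ D) xs)

-- Subsets are refinement types, whose elements are equal as soon as
-- their underlying values are.
Subsetᶠ : (X : FinSet) {P : Pred ⟨ X ⟩ 0ℓ} → Decidable P → FinSet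
Subsetᶠ X {P} P? = finSet [ x ∈ ⟨ X ⟩ ∣ P x ] (finite-Refinement (FinSet.finite X) P?)

------------------------------------------------------------------------
-- Label cover instances and minions

-- The finite list of constraints is a family indexed by a finite set:
-- c stands for the constraint  lhs c = act c (rhs c).
record LC : Set₁ where
  field
    Var : FinSet
    Dom : ⟨ Var ⟩ → FinSet
    Con : FinSet
    lhs : ⟨ Con ⟩ → ⟨ Var ⟩
    rhs : ⟨ Con ⟩ → ⟨ Var ⟩
    act : ∀ c → ⟨ Dom (rhs c) ⟩ → ⟨ Dom (lhs c) ⟩

-- Domains may be empty in general.  A minion whose set at the empty set
-- is empty rejects an instance with an empty domain; it may still accept
-- every instance with nonempty domains, e.g. if all its other sets are
-- singletons.
NonemptyDomains : LC → Set
NonemptyDomains 𝒟 = ∀ x → ⟨ Dom x ⟩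
  where open LC 𝒟

-- Sets are setoids and equality of functions between finite sets is
-- pointwise, hence map-cong.
record Minion (c ℓ : Level) : Set (lsuc (0ℓ ⊔ℓ c ⊔ℓ ℓ)) where
  field
    obj : FinSet → Setoid c ℓ

  ∣_∣ᴹ : FinSet → Set c
  ∣ D ∣ᴹ = Setoid.Carrier (obj D)

  infix 4 _≈_
  _≈_ : ∀ {D} → ∣ D ∣ᴹ → ∣ D ∣ᴹ → Set ℓ
  _≈_ {D} = Setoid._≈_ (obj D)

  field
    map      : ∀ {D E} → (⟨ D ⟩ → ⟨ E ⟩) → ∣ D ∣ᴹ → ∣ E ∣ᴹ
    map-resp : ∀ {D E} (α : ⟨ D ⟩ → ⟨ E ⟩) {r s : ∣ D ∣ᴹ} →
               _≈_ {D} r s → _≈_ {E} (map {D} {E} α r) (map {D} {E} α s)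
    map-cong : ∀ {D E} {α β : ⟨ D ⟩ → ⟨ E ⟩} → α ≗ β → ∀ (r : ∣ D ∣ᴹ) →
               _≈_ {E} (map {D} {E} α r) (map {D} {E} β r)
    map-id   : ∀ {D} (r : ∣ D ∣ᴹ) → _≈_ {D} (map {D} {D} id r) r
    map-∘    : ∀ {D E F} (β : ⟨ E ⟩ → ⟨ F ⟩) (α : ⟨ D ⟩ → ⟨ E ⟩) (r : ∣ D ∣ᴹ) →
               _≈_ {F} (map {D} {F} (β ∘ α) r) (map {E} {F} β (map {D} {E} α r))

record Solution {c ℓ} (ℛ : Minion c ℓ) (𝒟 : LC) : Set (c ⊔ℓ ℓ) where
  open Minion ℛ
  open LC 𝒟
  field
    val : ∀ x → ∣ Dom x ∣ᴹ
    sat : ∀ c → _≈_ {Dom (lhs c)}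
                    (val (lhs c))
                    (map {Dom (rhs c)} {Dom (lhs c)} (act c) (val (rhs c)))

-- Fails exactly for the minion that maps every finite set to the empty set.
Inhabited : ∀ {c ℓ} → Minion c ℓ → Set (lsuc 0ℓ ⊔ℓ c)
Inhabited ℛ = Σ[ D ∈ FinSet ] ∣ D ∣ᴹ
  where open Minion ℛ

------------------------------------------------------------------------
-- PCSP templates and instances

record Signature : Set₁ where
  field
    Sym : FinSet
    ar  : ⟨ Sym ⟩ → ℕ

  maxArity : ℕ
  maxArity = List.foldr _⊔_ 0 (List.tabulate (ar ∘ FinSet.enum Sym))

-- Relations on a finite set are decidable classically; constructively
-- this has to be required.
record Structure (Σ : Signature) : Set₁ where
  open Signature Σ
  field
    Univ : FinSet
    Rel  : (R : ⟨ Sym ⟩) → Pred (Vec ⟨ Univ ⟩ (ar R)) 0ℓ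
    Rel? : ∀ R → Decidable (Rel R)

record Homomorphism {Σ : Signature} (𝔸 𝔹 : Structure Σ) : Set where
  private
    module 𝔸 = Structure 𝔸
    module 𝔹 = Structure 𝔹
  field
    fun      : ⟨ 𝔸.Univ ⟩ → ⟨ 𝔹.Univ ⟩
    preserve : ∀ R {as} → 𝔸.Rel R as → 𝔹.Rel R (Vec.map fun as)

record Template (Σ : Signature) : Set₁ where
  field
    𝔸 𝔹 : Structure Σ
    hom : Homomorphism 𝔸 𝔹

module _ (Σ : Signature) where
  open Signature Σ

  record Formal (V : Set) : Set where
    constructor _at_
    field
      sym   : ⟨ Sym ⟩
      scope : Vec V (ar sym)

  -- The variables of an instance are exactly those occurring in its
  -- constraints; they are numbered by Fin vars.
  record Instance : Set where
    field
      vars        : ℕ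
      constraints : List (Formal (Fin vars))
      occurs      : ∀ x → ListAny.Any (λ c → x ∈ᵛ Formal.scope c) constraints

------------------------------------------------------------------------
-- Functions on a subset U of Fin n: Vec X ∣ U ∣ lists the values of a
-- function U → X in increasing order of the arguments.

index : {U : Subset n} {x : Fin n} → x ∈ U → Fin ∣ U ∣
index Vec.here                        = zero
index {U = inside  ∷ U} (Vec.there p) = suc (index p)
index {U = outside ∷ U} (Vec.there p) = index p

element : (U : Subset n) → Fin ∣ U ∣ → Σ[ x ∈ Fin n ] x ∈ U
element (inside  ∷ U) zero    = zero , Vec.here
element (inside  ∷ U) (suc i) = let x , p = element U i in suc x , Vec.there p
element (outside ∷ U) i       = let x , p = element U i in suc x , Vec.there p

apply : (U : Subset n) → Vec X ∣ U ∣ → ∀ {x} → x ∈ U → X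
apply U f p = lookup f (index p)

restrict : {U U′ : Subset n} → .(U ⊆ U′) → Vec X ∣ U′ ∣ → Vec X ∣ U ∣
restrict {U = U} {U′} U⊆U′ f = tabulate λ i →
  let x , p = element U i in apply U′ f (recompute (x ∈? U′) (U⊆U′ p))

element-index : {U : Subset n} {x : Fin n} (p : x ∈ U) → element U (index p) ≡ (x , p)
element-index Vec.here = refl
element-index {U = inside  ∷ U} (Vec.there p) rewrite element-index p = refl
element-index {U = outside ∷ U} (Vec.there p) rewrite element-index p = refl

apply-restrict : {U U′ : Subset n} (U⊆U′ : U ⊆ U′) (f : Vec X ∣ U′ ∣) →
                 ∀ {x} (p : x ∈ U) → apply U (restrict U⊆U′ f) p ≡ apply U′ f (U⊆U′ p)
apply-restrict {U = U} {U′} U⊆U′ f p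
  rewrite lookup∘tabulate
            (λ i → let x , q = element U i in apply U′ f (recompute (x ∈? U′) (U⊆U′ q)))
            (index p)
        | element-index p
  = cong (lookup f) (cong index
      ([]=-irrelevant (recompute (_ ∈? U′) (U⊆U′ p)) (U⊆U′ p)))

------------------------------------------------------------------------
-- The label cover instances of a PCSP instance

module _ {Σ : Signature} (𝔸 : Structure Σ) (ℐ : Instance Σ) where
  open Signature Σ
  open Structure 𝔸
  open Instance ℐ
  open Formal

  private
    con : Fin (length constraints) → Formal Σ (Fin vars)
    con = List.lookup constraints

  lc : LC
  lc = record
    { Var = FinType vars +ᶠ FinType (length constraints)
    ; Dom = λ { (inj₁ x) → Univ
              ; (inj₂ j) → Subsetᶠ (Univ ^ᶠ ar (sym (con j))) (Rel? (sym (con j))) }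
    ; Con = Σᶠ (FinType (length constraints)) (λ j → FinType (ar (sym (con j))))
    ; lhs = λ (j , i) → inj₁ (lookup (scope (con j)) i)
    ; rhs = λ (j , i) → inj₂ j
    ; act = λ (j , i) as → lookup (value as) i
    }

  -- f satisfies every constraint all of whose variables lie in U.
  IsPartialSolution : (U : Subset vars) → Vec ⟨ Univ ⟩ ∣ U ∣ → Set
  IsPartialSolution U f =
    ListAll.All (λ c → (ps : All (_∈ U) (scope c)) → Rel (sym c) (All.reduce (apply U f) ps))
                constraints

  isPartialSolution? : ∀ U → Decidable (IsPartialSolution U)
  isPartialSolution? U f = ListAll.all? dec constraints
    where
    dec : ∀ c → Dec ((ps : All (_∈ U) (scope c)) → Rel (sym c) (All.reduce (apply U f) ps))
    dec c with All.all? (_∈? U) (scope c)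
    ... | no ¬ps = yes λ ps → contradiction ps ¬ps
    ... | yes ps = map′
      (λ r qs → subst (λ qs → Rel (sym c) (All.reduce (apply U f) qs))
                      (All.irrelevant []=-irrelevant ps qs) r)
      (λ h → h ps)
      (Rel? (sym c) _)

  restrict-isPartialSolution :
    {U U′ : Subset vars} (U⊆U′ : U ⊆ U′) {f : Vec ⟨ Univ ⟩ ∣ U′ ∣} →
    IsPartialSolution U′ f → IsPartialSolution U (restrict U⊆U′ f)
  restrict-isPartialSolution {U} {U′} U⊆U′ {f} = ListAll.map λ {c} h ps →
    subst (Rel (sym c)) (reduce-restrict ps) (h (All.map U⊆U′ ps))
    where
    reduce-restrict : ∀ {n} {xs : Vec (Fin vars) n} (ps : All (_∈ U) xs) →
      All.reduce (apply U′ f) (All.map U⊆U′ ps) ≡ All.reduce (apply U (restrict U⊆U′ f)) ps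
    reduce-restrict []       = refl
    reduce-restrict (p ∷ ps) =
      cong₂ _∷_ (≡.sym (apply-restrict U⊆U′ f p))
                (reduce-restrict ps)

  PartialSolution : Subset vars → FinSet
  PartialSolution U = Subsetᶠ (Univ ^ᶠ ∣ U ∣) (isPartialSolution? U)

  res : {U U′ : Subset vars} → .(U ⊆ U′) → ⟨ PartialSolution U′ ⟩ → ⟨ PartialSolution U ⟩
  res U⊆U′ (f , [ s ]) = restrict U⊆U′ f , [ restrict-isPartialSolution U⊆U′ {f} s ]

  lcᵏ : ℕ → LC
  lcᵏ m = record
    { Var = Small
    ; Dom = λ U → PartialSolution (value U)
    ; Con = Subsetᶠ (Small ×ᶠ Small) {λ (U , U′) → value U ⊆ value U′}
                    (λ (U , U′) → value U ⊆? value U′)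
    ; lhs = λ c → proj₁ (value c)
    ; rhs = λ c → proj₂ (value c)
    ; act = λ { (_ , [ U⊆U′ ]) → res U⊆U′ }
    }
    where
    Small : FinSet
    Small = Subsetᶠ (finSet (Subset vars) (finite-Vec finite-Bool vars))
                    (λ U → ∣ U ∣ ≤? m)

------------------------------------------------------------------------
-- Saturated powers

withIdentities : LC → LC
withIdentities 𝒟 = record
  { Var = Var
  ; Dom = Dom
  ; Con = Con +ᶠ Var
  ; lhs = λ { (inj₁ c) → lhs c ; (inj₂ x) → x }
  ; rhs = λ { (inj₁ c) → rhs c ; (inj₂ x) → x }
  ; act = λ { (inj₁ c) → act c ; (inj₂ x) → id }
  }
  where open LC 𝒟

-- A function σ : [k] → [k] is the vector (σ(1), …, σ(k)), so that
-- x_σ(1) … x_σ(k) is Vec.map (lookup x) σ.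
pow : ℕ → LC → LC
pow k 𝒟 = record
  { Var = Var ^ᶠ k
  ; Dom = Πᶠ Dom
  ; Con = Con ^ᶠ k +ᶠ (Var ^ᶠ k) ×ᶠ (FinType k ^ᶠ k)
  ; lhs = λ { (inj₁ cs) → Vec.map lhs cs ; (inj₂ (xs , σ)) → Vec.map (lookup xs) σ }
  ; rhs = λ { (inj₁ cs) → Vec.map rhs cs ; (inj₂ (xs , σ)) → xs }
  ; act = λ { (inj₁ cs) ds → map⁺ (All.map (λ {c} → act c) (map⁻ ds))
            ; (inj₂ (xs , σ)) ds → map⁺ (All.universal (lookup⁺ ds) σ) }
  }
  where open LC (withIdentities 𝒟)

{-# OPTIONS --safe #-}

-- (1) For a tuple v of variables of lc(ℐ) let ⋃ v collect the variables of ℐ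
-- involved in v; it has at most n k elements, and the value at v is the image
-- of the value at ⋃ v under evaluation of a partial solution on the entries of v.
--
-- (2) Call r ∈ ℛ(D) supported on S ⊆ D if any two maps that agree on S agree on
-- r.  Supports are closed under intersection, and r is supported on {α = β} as
-- soon as (id, α) and (id, β) agree on r; an element supported on ∅ would solve
-- every instance with nonempty domains by constant maps.  For ∣U∣ ≤ k the value
-- at (y₀, U) gives an element s of ℛ(A^U).  If a constraint y has its scope in
-- U, replace one variable of U by y: everything in U can still be read off, and
-- the spare slot y₀ compares each coordinate of y with the corresponding
-- variable of U.  So s is supported on the assignments satisfying y, hence
-- on the partial solutions, and retracting onto these solves lc^k(ℐ).
module Submission where

open import Defs
open import Data.Fin as Fin using (Fin; zero; suc)
import Data.Fin.Properties as Fin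
open import Data.Fin.Subset using (Subset; inside; outside; _∈_; _⊆_; ∣_∣; ⊥; ⁅_⁆; _∪_)
open import Data.Fin.Subset.Properties
  using (_∈?_; _⊆?_; ∉⊥; ∣⊥∣≡0; ∣⁅x⁆∣≡1; x∈⁅x⁆; x∈⁅y⁆⇒x≡y; p⊆p∪q; q⊆p∪q; x∈p∪q⁻)
open import Data.Irrelevant using ([_])
open import Data.List as List using (List; []; _∷_; length)
open import Data.List.Membership.Propositional.Properties using (∈-lookup)
open import Data.List.Properties using (tabulate-lookup)
import Data.List.Relation.Unary.All as ListAll
import Data.List.Relation.Unary.All.Properties as ListAll
import Data.List.Relation.Unary.Any as ListAny
open import Data.Maybe as Maybe using (Maybe; just; nothing)
open import Data.Nat using (ℕ; zero; suc; _≤_; _≤?_; _⊔_; _+_; _*_; z≤n; s≤s)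
import Data.Nat.Properties as ℕ
open import Data.Product using (∃; ∃-syntax; Σ-syntax; _×_; _,_; proj₁; proj₂)
open import Data.Refinement using (value; value-injective; _,_)
open import Data.Sum using (_⊎_; inj₁; inj₂; [_,_]′)
open import Data.Unit using (⊤)
open import Data.Vec as Vec using (Vec; []; _∷_; lookup; tabulate)
import Data.Vec.Functional as Vector
open import Data.Vec.Functional.Properties using (updateAt-updates; updateAt-minimal)
open import Data.Vec.Membership.Propositional using () renaming (_∈_ to _∈ᵛ_)
open import Data.Vec.Properties using (lookup∘tabulate; tabulate∘lookup; tabulate-cong)
open import Data.Vec.Properties.WithK using ([]=-irrelevant)
open import Data.Vec.Relation.Binary.Pointwise.Inductive using (Pointwise; []; _∷_)
open import Data.Vec.Relation.Unary.All as All using (All; []; _∷_)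
open import Data.Vec.Relation.Unary.All.Properties
  using (map⁺; map⁻; lookup⁺; tabulate⁺; tabulate⁻)
open import Function using (_∘_; id; const)
open import Function.Bundles using (module Inverse)
open import Level using (0ℓ) renaming (suc to lsuc; _⊔_ to _⊔ℓ_)
open import Relation.Binary using (Setoid; DecidableEquality)
open import Relation.Binary.PropositionalEquality
  using (_≡_; refl; sym; trans; cong; cong₂; subst; subst₂; dcong; subst-∘)
import Relation.Binary.Reasoning.Setoid as SetoidReasoning
open import Relation.Nullary using (¬_; Dec; yes; no; contradiction; recompute)
open import Relation.Nullary.Decidable using (map′)
open import Relation.Unary using (Pred; Decidable)

-- Decidability and retractions on finite sets

≡-finite : (D : FinSet) → DecidableEquality ⟨ D ⟩
≡-finite D x y = map′ injective (cong to) (to x Fin.≟ to y)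
  where
  open Inverse (proj₂ (FinSet.finite D))
  injective : to x ≡ to y → x ≡ y
  injective eq = trans (sym (strictlyInverseʳ x)) (trans (cong from eq) (strictlyInverseʳ y))

∃? : (D : FinSet) {P : Pred ⟨ D ⟩ 0ℓ} → Decidable P → Dec (∃ P)
∃? D {P} P? = map′
  (λ (i , p) → from i , p)
  (λ (x , p) → to x , subst P (sym (strictlyInverseʳ x)) p)
  (Fin.any? (P? ∘ from))
  where open Inverse (proj₂ (FinSet.finite D))

-- Points outside `S` all go to the arbitrary default `s₀`. An element supported on `S` does not see
-- this choice.
module Retraction {D : FinSet} {S : Pred ⟨ D ⟩ 0ℓ} (S? : Decidable S) (s₀ : ∃ S) where

  retract : ⟨ D ⟩ → ⟨ Subsetᶠ D S? ⟩
  retract d with S? d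
  ... | yes s = d , [ s ]
  ... | no  _ = proj₁ s₀ , [ proj₂ s₀ ]

  retract-value : ∀ {d} → S d → value (retract d) ≡ d
  retract-value {d} s with S? d
  ... | yes _ = refl
  ... | no ¬s = contradiction s ¬s

  retract-∈ : ∀ d (s : S d) → retract d ≡ (d , [ s ])
  retract-∈ d s = value-injective (retract-value s)

-- Supports of elements of a minion

-- Indexed by both endpoints, so that edges can be transported along equations between variables and
-- matching on `edge` recovers the constraint.
data Edge (𝒟 : LC) : ⟨ LC.Var 𝒟 ⟩ → ⟨ LC.Var 𝒟 ⟩ → Set where
  edge : ∀ c → Edge 𝒟 (LC.lhs 𝒟 c) (LC.rhs 𝒟 c)

along : ∀ {𝒟 x y} → Edge 𝒟 x y → ⟨ LC.Dom 𝒟 y ⟩ → ⟨ LC.Dom 𝒟 x ⟩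
along {𝒟} (edge c) = LC.act 𝒟 c

module Support {c ℓ} (ℛ : Minion c ℓ) where
  open Minion ℛ

  -- A maps-only form of "r lies in the image of ℛ(S)": it makes sense for
  -- empty S and is stable under intersections without exception.
  Supported : (D : FinSet) → Pred ⟨ D ⟩ 0ℓ → ∣ D ∣ᴹ → Set (lsuc 0ℓ ⊔ℓ ℓ)
  Supported D S r = ∀ E (f g : ⟨ D ⟩ → ⟨ E ⟩) → (∀ {d} → S d → f d ≡ g d) →
                    _≈_ {E} (map {D} {E} f r) (map {D} {E} g r)

  module _ {D : FinSet} {r : ∣ D ∣ᴹ} where

    supported-all : {S : Pred ⟨ D ⟩ 0ℓ} → (∀ d → S d) → Supported D S r
    supported-all all E f g f≗g = map-cong {D} {E} (λ d → f≗g (all d)) r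

    -- Pass from `f` to `g` through the map `h` that is `f` on `S` and `g` elsewhere: `f` and `h`
    -- agree on `S`, while `h` and `g` agree on `T` because `f` and `g` agree on the intersection.
    supported-∩ : {S T : Pred ⟨ D ⟩ 0ℓ} → Decidable S → Supported D S r → Supported D T r →
                  Supported D (λ d → S d × T d) r
    supported-∩ {S} {T} S? suppS suppT E f g f≗g =
      Setoid.trans (obj E) (suppS E f h (λ {d} s → onS d s)) (suppT E h g (λ {d} t → onT d t))
      where
      h : ⟨ D ⟩ → ⟨ E ⟩
      h d with S? d
      ... | yes _ = f d
      ... | no  _ = g d

      onS : ∀ d → S d → f d ≡ h d
      onS d s with S? d
      ... | yes _ = refl
      ... | no ¬s = contradiction s ¬s

      onT : ∀ d → T d → h d ≡ g d
      onT d t with S? d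
      ... | yes s = f≗g (s , t)
      ... | no  _ = refl

    supported-⋂ : ∀ n {S : Fin n → Pred ⟨ D ⟩ 0ℓ} → (∀ i → Decidable (S i)) →
                  (∀ i → Supported D (S i) r) → Supported D (λ d → ∀ i → S i d) r
    supported-⋂ zero    S? supp = supported-all (λ _ ())
    supported-⋂ (suc n) S? supp E f g f≗g =
      supported-∩ (S? zero) (supp zero) (supported-⋂ n (S? ∘ suc) (supp ∘ suc)) E f g
        (λ (s , ss) → f≗g λ { zero → s ; (suc i) → ss i })

    supported-map : ∀ {E} (h : ⟨ D ⟩ → ⟨ E ⟩) {S : Pred ⟨ D ⟩ 0ℓ} {T : Pred ⟨ E ⟩ 0ℓ} →
                    (∀ {d} → S d → T (h d)) → Supported D S r →
                    Supported E T (map {D} {E} h r)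
    supported-map {E} h S⊆T supp F f g f≗g = begin
      map {E} {F} f (map {D} {E} h r)  ≈⟨ map-∘ {D} {E} {F} f h r ⟨
      map {D} {F} (f ∘ h) r            ≈⟨ supp F (f ∘ h) (g ∘ h) (λ s → f≗g (S⊆T s)) ⟩
      map {D} {F} (g ∘ h) r            ≈⟨ map-∘ {D} {E} {F} g h r ⟩
      map {E} {F} g (map {D} {E} h r)  ∎
      where open SetoidReasoning (obj F)

    supported-resp : ∀ {s} {S : Pred ⟨ D ⟩ 0ℓ} → _≈_ {D} r s → Supported D S r → Supported D S s
    supported-resp {s} r≈s supp E f g f≗g = begin
      map {D} {E} f s  ≈⟨ map-resp {D} {E} f r≈s ⟨
      map {D} {E} f r  ≈⟨ supp E f g f≗g ⟩
      map {D} {E} g r  ≈⟨ map-resp {D} {E} g r≈s ⟩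
      map {D} {E} g s  ∎
      where open SetoidReasoning (obj E)

    -- Glue f and g to one map on D × A that restricts to f along the graph
    -- of α and to g along the graph of β.
    supported-equalizer : ∀ A (α β : ⟨ D ⟩ → ⟨ A ⟩) →
      _≈_ {D ×ᶠ A} (map {D} {D ×ᶠ A} (λ d → d , α d) r) (map {D} {D ×ᶠ A} (λ d → d , β d) r) →
      Supported D (λ d → α d ≡ β d) r
    supported-equalizer A α β eq E f g f≗g = begin
      map {D} {E} f r                                        ≈⟨ map-cong {D} {E} on-α r ⟨
      map {D} {E} (λ d → h (d , α d)) r                      ≈⟨ map-∘ {D} {D ×ᶠ A} {E} h _ r ⟩
      map {D ×ᶠ A} {E} h (map {D} {D ×ᶠ A} (λ d → d , α d) r)  ≈⟨ map-resp {D ×ᶠ A} {E} h eq ⟩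
      map {D ×ᶠ A} {E} h (map {D} {D ×ᶠ A} (λ d → d , β d) r)  ≈⟨ map-∘ {D} {D ×ᶠ A} {E} h _ r ⟨
      map {D} {E} (λ d → h (d , β d)) r                      ≈⟨ map-cong {D} {E} on-β r ⟩
      map {D} {E} g r                                        ∎
      where
      open SetoidReasoning (obj E)
      h : ⟨ D ×ᶠ A ⟩ → ⟨ E ⟩
      h (d , a) with ≡-finite A (α d) a
      ... | yes _ = f d
      ... | no  _ = g d

      on-α : ∀ d → h (d , α d) ≡ f d
      on-α d with ≡-finite A (α d) (α d)
      ... | yes _ = refl
      ... | no  ≢ = contradiction refl ≢

      on-β : ∀ d → h (d , β d) ≡ g d
      on-β d with ≡-finite A (α d) (β d)
      ... | yes α≡β = f≗g α≡β
      ... | no  _   = refl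

  -- Stated for an arbitrary instance: for the concrete ones, type checking
  -- would compare the unfolded finiteness proofs of their domains.
  module _ (𝒟 : LC) where
    open LC 𝒟

    solve : (D : ⟨ Var ⟩ → FinSet) (r : ∀ x → ∣ D x ∣ᴹ)
      (S : ∀ x → Pred ⟨ D x ⟩ 0ℓ) → (∀ x → Supported (D x) (S x) (r x)) →
      (π : ∀ x → ⟨ D x ⟩ → ⟨ Dom x ⟩) →
      (∀ c → Σ[ ρ ∈ (⟨ D (rhs c) ⟩ → ⟨ D (lhs c) ⟩) ]
               _≈_ {D (lhs c)} (r (lhs c)) (map {D (rhs c)} {D (lhs c)} ρ (r (rhs c))) ×
               (∀ {d} → S (rhs c) d → π (lhs c) (ρ d) ≡ act c (π (rhs c) d))) →
      Solution ℛ 𝒟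
    solve D r S supp π step = record { val = val ; sat = sat }
      where
      val : ∀ x → ∣ Dom x ∣ᴹ
      val x = map {D x} {Dom x} (π x) (r x)

      sat : ∀ c → _≈_ {Dom (lhs c)} (val (lhs c))
                      (map {Dom (rhs c)} {Dom (lhs c)} (act c) (val (rhs c)))
      sat c with step c
      ... | ρ , r≈ , eq = begin
        map {Dx} {Ex} (π x) (r x)                     ≈⟨ map-resp {Dx} {Ex} (π x) r≈ ⟩
        map {Dx} {Ex} (π x) (map {Dy} {Dx} ρ (r y))   ≈⟨ map-∘ {Dy} {Dx} {Ex} (π x) ρ (r y) ⟨
        -- The square formed by `π`, `ρ` and `act c` need only commute on `S y`; the support of
        -- `r y` takes care of the other points.
        map {Dy} {Ex} (π x ∘ ρ) (r y)                 ≈⟨ supp y Ex (π x ∘ ρ) (act c ∘ π y) eq ⟩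
        map {Dy} {Ex} (act c ∘ π y) (r y)             ≈⟨ map-∘ {Dy} {Dom y} {Ex} (act c) (π y) (r y) ⟩
        map {Dom y} {Ex} (act c) (val y)              ∎
        where
        x = lhs c
        y = rhs c
        Dx = D x
        Dy = D y
        Ex = Dom x
        open SetoidReasoning (obj Ex)

  module _ {𝒞 𝒟 : LC} where
    private
      module 𝒞 = LC 𝒞
      module 𝒟 = LC 𝒟

    -- The case of `solve` with full supports: each constraint of `𝒟` lies over a single constraint
    -- of `𝒞`, and `π` commutes with the two actions everywhere.
    transfer : Solution ℛ 𝒞 →
      (φ : ⟨ 𝒟.Var ⟩ → ⟨ 𝒞.Var ⟩) (π : ∀ x → ⟨ 𝒞.Dom (φ x) ⟩ → ⟨ 𝒟.Dom x ⟩) →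
      (∀ c → Σ[ e ∈ Edge 𝒞 (φ (𝒟.lhs c)) (φ (𝒟.rhs c)) ]
               (∀ d → π (𝒟.lhs c) (along e d) ≡ 𝒟.act c (π (𝒟.rhs c) d))) →
      Solution ℛ 𝒟
    transfer sol φ π step = solve 𝒟 (𝒞.Dom ∘ φ) (val ∘ φ) (λ _ _ → ⊤) (λ _ → supported-all λ _ → _) π
      (λ c → let e , eq = step c in along e , edge-sat e , λ {d} _ → eq d)
      where
      open Solution sol

      edge-sat : ∀ {x y} (e : Edge 𝒞 x y) →
                 _≈_ {𝒞.Dom x} (val x) (map {𝒞.Dom y} {𝒞.Dom x} (along e) (val y))
      edge-sat (edge c) = sat c

  module _ (nontrivial : ¬ (∀ 𝒟 → NonemptyDomains 𝒟 → Solution ℛ 𝒟)) where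

    -- Were `S` empty, all maps from `D` to a given set would agree on `r`. The images of `r` under
    -- the constant maps to arbitrary points `e x` would then satisfy every constraint, against
    -- `nontrivial`.
    supported⇒∃ : ∀ {D} {S : Pred ⟨ D ⟩ 0ℓ} {r : ∣ D ∣ᴹ} → Decidable S → Supported D S r → ∃ S
    supported⇒∃ {D} {S} {r} S? supp with ∃? D S?
    ... | yes s = s
    ... | no ¬s = contradiction
      (λ 𝒟 e → solve 𝒟 (const D) (const r) (λ _ → S) (λ _ → supp) (λ x _ → e x)
        λ c → id , Setoid.sym (obj D) (map-id {D} r) , λ s → contradiction (_ , s) ¬s)
      nontrivial

-- Reading one tuple of a saturated power off another

tabulate⁻∘tabulate⁺ : ∀ {X : Set} {P : X → Set} {n} {f : Fin n → X} (ps : ∀ i → P (f i)) →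
                      ∀ i → tabulate⁻ {P = P} {f = f} (tabulate⁺ ps) i ≡ ps i
tabulate⁻∘tabulate⁺ ps zero    = refl
tabulate⁻∘tabulate⁺ ps (suc i) = tabulate⁻∘tabulate⁺ (ps ∘ suc) i

module Tuples (𝒟 : LC) where
  open LC (withIdentities 𝒟)

  Link : ⟨ Var ⟩ → ⟨ Var ⟩ → Set
  Link = Edge (withIdentities 𝒟)

  Values : ∀ {k} → (Fin k → ⟨ Var ⟩) → Set
  Values z = ∀ j → ⟨ Dom (z j) ⟩

  -- A single link is enough for every use: identity links copy a coordinate, and projection links
  -- extract a variable from a constraint.
  Read : ∀ {k} → (Fin k → ⟨ Var ⟩) → ⟨ Var ⟩ → Set
  Read z x = ∃[ j ] Link x (z j)

  read : ∀ {k} {z : Fin k → ⟨ Var ⟩} {x} → Read z x → Values z → ⟨ Dom x ⟩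
  read (j , e) d = along e (d j)

  position : ∀ {k} {z : Fin k → ⟨ Var ⟩} j → Read z (z j)
  position j = j , edge (inj₂ _)

  read-subst : ∀ {k} {z : Fin k → ⟨ Var ⟩} {x y} (x≡y : x ≡ y) (ρ : Read z x) (d : Values z) →
              read (subst (Read z) x≡y ρ) d ≡ subst (⟨_⟩ ∘ Dom) x≡y (read ρ d)
  read-subst refl ρ d = refl

  private
    alongAll : ∀ {k} {w v : Vec ⟨ Var ⟩ k} → Pointwise Link w v →
               All (⟨_⟩ ∘ Dom) v → All (⟨_⟩ ∘ Dom) w
    alongAll []       []       = []
    alongAll (e ∷ es) (d ∷ ds) = along e d ∷ alongAll es ds

    edges : ∀ {k} (cs : Vec ⟨ Con ⟩ k) → Pointwise Link (Vec.map lhs cs) (Vec.map rhs cs)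
    edges []       = []
    edges (c ∷ cs) = edge c ∷ edges cs

    -- Turns a coordinatewise family of links back into one `k`-tuple of constraints, the form in
    -- which the first kind of constraints of the power is indexed. `PositionsView` does the same
    -- for the second kind.
    data EdgesView : ∀ {k} {w v : Vec ⟨ Var ⟩ k} → Pointwise Link w v → Set where
      view : ∀ {k} (cs : Vec ⟨ Con ⟩ k) → EdgesView (edges cs)

    edgesView : ∀ {k} {w v : Vec ⟨ Var ⟩ k} (es : Pointwise Link w v) → EdgesView es
    edgesView []            = view []
    edgesView (edge c ∷ es) with edgesView es
    ... | view cs = view (c ∷ cs)

    along-edges : ∀ {k} (cs : Vec ⟨ Con ⟩ k) (ds : All (⟨_⟩ ∘ Dom) (Vec.map rhs cs)) →
                  map⁺ (All.map (λ {c} → act c) (map⁻ ds)) ≡ alongAll (edges cs) ds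
    along-edges []       []       = refl
    along-edges (c ∷ cs) (d ∷ ds) = cong (act c d ∷_) (along-edges cs ds)

    -- Carries an equation because looking up in `tabulate z` returns `z j` only propositionally.
    At : ∀ {k} → Vec ⟨ Var ⟩ k → ⟨ Var ⟩ → Set
    At z x = ∃[ j ] lookup z j ≡ x

    pick : ∀ {k} {z : Vec ⟨ Var ⟩ k} → All (⟨_⟩ ∘ Dom) z → ∀ {x} → At z x → ⟨ Dom x ⟩
    pick ds (j , eq) = subst (⟨_⟩ ∘ Dom) eq (lookup⁺ ds j)

    positions : ∀ {k n} (z : Vec ⟨ Var ⟩ k) (σ : Vec (Fin k) n) → All (At z) (Vec.map (lookup z) σ)
    positions z []      = []
    positions z (j ∷ σ) = (j , refl) ∷ positions z σ

    data PositionsView {k} (z : Vec ⟨ Var ⟩ k) : ∀ {n} {v : Vec ⟨ Var ⟩ n} → All (At z) v → Set where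
      view : ∀ {n} (σ : Vec (Fin k) n) → PositionsView z (positions z σ)

    positionsView : ∀ {k n} {z : Vec ⟨ Var ⟩ k} {v : Vec ⟨ Var ⟩ n} (as : All (At z) v) →
                    PositionsView z as
    positionsView         []                = view []
    positionsView {z = z} ((j , refl) ∷ as) with positionsView {z = z} as
    ... | view σ = view (j ∷ σ)

    pick-positions : ∀ {k n} (z : Vec ⟨ Var ⟩ k) (σ : Vec (Fin k) n) (ds : All (⟨_⟩ ∘ Dom) z) →
                     map⁺ (All.universal (lookup⁺ ds) σ) ≡ All.map (pick ds) (positions z σ)
    pick-positions z []      ds = refl
    pick-positions z (j ∷ σ) ds = cong (lookup⁺ ds j ∷_) (pick-positions z σ ds)

    -- Simultaneous reading factors through this tuple: first select, with repetition, the
    -- coordinates of `z` that are read (a constraint of the second kind), then follow one link in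
    -- each coordinate (the first kind).
    middle : ∀ {k n} {z : Fin k → ⟨ Var ⟩} {w : Fin n → ⟨ Var ⟩} →
             (∀ i → Read z (w i)) → Vec ⟨ Var ⟩ n
    middle {z = z} ρ = tabulate (z ∘ proj₁ ∘ ρ)

    middle-edges : ∀ {k n} {z : Fin k → ⟨ Var ⟩} {w : Fin n → ⟨ Var ⟩} (ρ : ∀ i → Read z (w i)) →
                   Pointwise Link (tabulate w) (middle {z = z} {w} ρ)
    middle-edges {n = zero}  ρ = []
    middle-edges {n = suc n} ρ = proj₂ (ρ zero) ∷ middle-edges (ρ ∘ suc)

    middle-positions : ∀ {k n} {z : Fin k → ⟨ Var ⟩} {w : Fin n → ⟨ Var ⟩} (ρ : ∀ i → Read z (w i)) →
                       All (At (tabulate z)) (middle {z = z} {w} ρ)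
    middle-positions {z = z} ρ = tabulate⁺ λ i → proj₁ (ρ i) , lookup∘tabulate z (proj₁ (ρ i))

    pick-tabulate : ∀ {k} (z : Fin k → ⟨ Var ⟩) (ds : All (⟨_⟩ ∘ Dom) (tabulate z)) j →
                    pick ds (j , lookup∘tabulate z j) ≡ tabulate⁻ ds j
    pick-tabulate z (d ∷ ds) zero    = refl
    pick-tabulate z (d ∷ ds) (suc j) = pick-tabulate (z ∘ suc) ds j

  readAll : ∀ {k n} {z : Fin k → ⟨ Var ⟩} {w : Fin n → ⟨ Var ⟩} → (∀ i → Read z (w i)) →
            All (⟨_⟩ ∘ Dom) (tabulate z) → All (⟨_⟩ ∘ Dom) (tabulate w)
  readAll ρ ds = tabulate⁺ λ i → read (ρ i) (tabulate⁻ ds)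

  private
    readAll-middle : ∀ {k n} {z : Fin k → ⟨ Var ⟩} {w : Fin n → ⟨ Var ⟩} (ρ : ∀ i → Read z (w i))
      (ds : All (⟨_⟩ ∘ Dom) (tabulate z)) →
      readAll {w = w} ρ ds ≡ alongAll (middle-edges ρ) (All.map (pick ds) (middle-positions ρ))
    readAll-middle {n = zero}          ρ ds = refl
    readAll-middle {n = suc n} {z} {w} ρ ds =
      cong₂ _∷_ (cong (along (proj₂ (ρ zero))) (sym (pick-tabulate z ds _)))
                (readAll-middle {w = w ∘ suc} (ρ ∘ suc) ds)

  weaken : ∀ {k y x} {z : Fin k → ⟨ Var ⟩} → Read z x → Read (y Vector.∷ z) x
  weaken (j , e) = suc j , e

  dropZero : ∀ {k y} {z : Fin k → ⟨ Var ⟩} → Values (y Vector.∷ z) → Values z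
  dropZero d = d ∘ suc

  module _ {c ℓ} (ℛ : Minion c ℓ) {k} (sol : Solution ℛ (pow k 𝒟)) where
    open Minion ℛ
    open Solution sol

    private
      along-sat : ∀ {w v : Vec ⟨ Var ⟩ k} (es : Pointwise Link w v) →
                  _≈_ {Πᶠ Dom w} (val w) (map {Πᶠ Dom v} {Πᶠ Dom w} (alongAll es) (val v))
      along-sat {w} {v} es with edgesView es
      ... | view cs = Setoid.trans (obj (Πᶠ Dom w)) (sat (inj₁ cs))
                        (map-cong {Πᶠ Dom v} {Πᶠ Dom w} (along-edges cs) (val v))

      pick-sat : ∀ {z v : Vec ⟨ Var ⟩ k} (as : All (At z) v) →
                 _≈_ {Πᶠ Dom v} (val v) (map {Πᶠ Dom z} {Πᶠ Dom v} (λ ds → All.map (pick ds) as) (val z))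
      pick-sat {z} {v} as with positionsView {z = z} as
      ... | view σ = Setoid.trans (obj (Πᶠ Dom v)) (sat (inj₂ (z , σ)))
                       (map-cong {Πᶠ Dom z} {Πᶠ Dom v} (pick-positions z σ) (val z))

      readAll-sat : ∀ {z w : Fin k → ⟨ Var ⟩} (ρ : ∀ i → Read z (w i)) →
        _≈_ {Πᶠ Dom (tabulate w)} (val (tabulate w))
            (map {Πᶠ Dom (tabulate z)} {Πᶠ Dom (tabulate w)} (readAll ρ) (val (tabulate z)))
      readAll-sat {z} {w} ρ = begin
        val (tabulate w)                                     ≈⟨ along-sat (middle-edges ρ) ⟩
        map {Y} {W} (alongAll (middle-edges ρ)) (val (middle ρ))
          ≈⟨ map-resp {Y} {W} _ (pick-sat (middle-positions ρ)) ⟩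
        map {Y} {W} (alongAll (middle-edges ρ))
          (map {Z} {Y} (λ ds → All.map (pick ds) (middle-positions ρ)) (val (tabulate z)))
          ≈⟨ map-∘ {Z} {Y} {W} _ _ _ ⟨
        map {Z} {W} (λ ds → alongAll (middle-edges ρ) (All.map (pick ds) (middle-positions ρ)))
          (val (tabulate z))
          ≈⟨ map-cong {Z} {W} (readAll-middle ρ) _ ⟨
        map {Z} {W} (readAll ρ) (val (tabulate z))           ∎
        where
        Z = Πᶠ Dom (tabulate z)
        Y = Πᶠ Dom (middle {z = z} {w} ρ)
        W = Πᶠ Dom (tabulate w)
        open SetoidReasoning (obj W)

    abstract
      push : ∀ E (z : Fin k → ⟨ Var ⟩) → (Values z → ⟨ E ⟩) → ∣ E ∣ᴹ
      push E z h = map {Πᶠ Dom (tabulate z)} {E} (h ∘ tabulate⁻) (val (tabulate z))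

      -- If `w` can be read off `z`, the element at `w` is an image of the element at `z`. The
      -- hypothesis on `h` stands in for function extensionality, since the values read agree only
      -- pointwise after tabulation.
      push-read : ∀ {E F} {z w : Fin k → ⟨ Var ⟩} (ρ : ∀ i → Read z (w i)) (h : Values w → ⟨ F ⟩) →
        (∀ {d d′ : Values w} → (∀ i → d i ≡ d′ i) → h d ≡ h d′) →
        (γ : ⟨ E ⟩ → ⟨ F ⟩) (g : Values z → ⟨ E ⟩) →
        (∀ d → h (λ i → read (ρ i) d) ≡ γ (g d)) →
        _≈_ {F} (push F w h) (map {E} {F} γ (push E z g))
      push-read {E} {F} {z} {w} ρ h h-ext γ g eq = begin
        map {W} {F} (h ∘ tabulate⁻) (val (tabulate w))
          ≈⟨ map-resp {W} {F} _ (readAll-sat ρ) ⟩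
        map {W} {F} (h ∘ tabulate⁻) (map {Z} {W} (readAll ρ) (val (tabulate z)))
          ≈⟨ map-∘ {Z} {W} {F} _ _ _ ⟨
        map {Z} {F} (h ∘ tabulate⁻ ∘ readAll ρ) (val (tabulate z))
          ≈⟨ map-cong {Z} {F} (λ ds → trans
               (h-ext (tabulate⁻∘tabulate⁺ {P = ⟨_⟩ ∘ Dom} {f = w} _)) (eq (tabulate⁻ ds))) _ ⟩
        map {Z} {F} (γ ∘ g ∘ tabulate⁻) (val (tabulate z))
          ≈⟨ map-∘ {Z} {E} {F} γ (g ∘ tabulate⁻) _ ⟩
        map {E} {F} γ (map {Z} {E} (g ∘ tabulate⁻) (val (tabulate z)))
          ∎
        where
        Z W : FinSet
        Z = Πᶠ Dom (tabulate z)
        W = Πᶠ Dom (tabulate w)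
        open SetoidReasoning (obj F)

  -- Overwriting the spare slot in front by x, once along ρ and once along σ,
  -- gives the same tuple, hence the same element.
  module _ {c ℓ} (ℛ : Minion c ℓ) {k} (sol : Solution ℛ (pow (suc k) 𝒟)) where
    open Minion ℛ
    open Support ℛ

    supported-reads : ∀ {E y x} {z : Fin k → ⟨ Var ⟩} (ρ σ : Read z x) (g : Values z → ⟨ E ⟩) →
      (∀ {d d′ : Values z} → (∀ i → d i ≡ d′ i) → g d ≡ g d′) →
      (α β : ⟨ E ⟩ → ⟨ Dom x ⟩) → (∀ d → read ρ d ≡ α (g d)) → (∀ d → read σ d ≡ β (g d)) →
      Supported E (λ e → α e ≡ β e) (push ℛ sol E (y Vector.∷ z) (λ d → g (dropZero {y = y} d)))
    supported-reads {E} {y} {x} {z} ρ σ g g-ext α β ρ≗α σ≗β =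
      supported-equalizer (Dom x) α β
        (Setoid.trans (obj (E ×ᶠ Dom x))
          (Setoid.sym (obj (E ×ᶠ Dom x)) (push-at ρ α ρ≗α)) (push-at σ β σ≗β))
      where
      w : Fin (suc k) → ⟨ Var ⟩
      w = x Vector.∷ z

      h : Values w → ⟨ E ⟩ × ⟨ Dom x ⟩
      h d = g (dropZero {y = x} d) , d zero

      reads : Read z x → ∀ l → Read (y Vector.∷ z) (w l)
      reads τ zero    = weaken {y = y} τ
      reads τ (suc l) = suc l , edge (inj₂ _)

      push-at : (τ : Read z x) (γ : ⟨ E ⟩ → ⟨ Dom x ⟩) → (∀ d → read τ d ≡ γ (g d)) →
        _≈_ {E ×ᶠ Dom x} (push ℛ sol (E ×ᶠ Dom x) w h)
          (map {E} {E ×ᶠ Dom x} (λ e → e , γ e) (push ℛ sol E (y Vector.∷ z) (λ d → g (dropZero {y = y} d))))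
      push-at τ γ τ≗γ = push-read ℛ sol {E} {E ×ᶠ Dom x} {y Vector.∷ z} {w} (reads τ) h
        (λ d≗d′ → cong₂ _,_ (g-ext (λ i → d≗d′ (suc i))) (d≗d′ zero))
        (λ e → e , γ e) (λ d → g (dropZero {y = y} d))
        (λ d → cong (λ a → g (dropZero {y = y} d) , a) (τ≗γ (dropZero {y = y} d)))

-- Entrywise reasoning on vectors and lists

lookup-ext : ∀ {X : Set} {n} {xs ys : Vec X n} → (∀ i → lookup xs i ≡ lookup ys i) → xs ≡ ys
lookup-ext {xs = xs} {ys} eq =
  trans (sym (tabulate∘lookup xs)) (trans (tabulate-cong eq) (tabulate∘lookup ys))

lookup-reduce : ∀ {X Y : Set} {P : Pred X 0ℓ} (f : ∀ {x} → P x → Y) {n} {xs : Vec X n}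
                (ps : All P xs) i → lookup (All.reduce f ps) i ≡ f (lookup⁺ ps i)
lookup-reduce f (p ∷ ps) zero    = refl
lookup-reduce f (p ∷ ps) (suc i) = lookup-reduce f ps i

all-lookup⁻ : ∀ {X : Set} {P : Pred X 0ℓ} (xs : List X) → (∀ i → P (List.lookup xs i)) →
              ListAll.All P xs
all-lookup⁻ {P = P} xs h = subst (ListAll.All P) (tabulate-lookup xs) (ListAll.tabulate⁺ h)

-- From lcᵏ to the saturated power

∣p∪q∣≤∣p∣+∣q∣ : ∀ {n} (p q : Subset n) → ∣ p ∪ q ∣ ≤ ∣ p ∣ + ∣ q ∣
∣p∪q∣≤∣p∣+∣q∣ []            []            = z≤n
∣p∪q∣≤∣p∣+∣q∣ (outside ∷ p) (outside ∷ q) = ∣p∪q∣≤∣p∣+∣q∣ p q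
∣p∪q∣≤∣p∣+∣q∣ (outside ∷ p) (inside  ∷ q) =
  ℕ.≤-trans (s≤s (∣p∪q∣≤∣p∣+∣q∣ p q)) (ℕ.≤-reflexive (sym (ℕ.+-suc ∣ p ∣ ∣ q ∣)))
∣p∪q∣≤∣p∣+∣q∣ (inside  ∷ p) (outside ∷ q) = s≤s (∣p∪q∣≤∣p∣+∣q∣ p q)
∣p∪q∣≤∣p∣+∣q∣ (inside  ∷ p) (inside  ∷ q) =
  s≤s (ℕ.≤-trans (∣p∪q∣≤∣p∣+∣q∣ p q) (ℕ.+-monoʳ-≤ ∣ p ∣ (ℕ.n≤1+n ∣ q ∣)))

module _ {X : Set} {n} (F : X → Subset n) where

  unions : ∀ {k} → Vec X k → Subset n
  unions []       = ⊥
  unions (x ∷ xs) = F x ∪ unions xs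

  ∣unions∣≤ : ∀ {b} → (∀ x → ∣ F x ∣ ≤ b) → ∀ {k} (xs : Vec X k) → ∣ unions xs ∣ ≤ k * b
  ∣unions∣≤ F≤b []       = ℕ.≤-reflexive (∣⊥∣≡0 n)
  ∣unions∣≤ F≤b (x ∷ xs) =
    ℕ.≤-trans (∣p∪q∣≤∣p∣+∣q∣ (F x) (unions xs)) (ℕ.+-mono-≤ (F≤b x) (∣unions∣≤ F≤b xs))

  ⊆unions : ∀ {k} (xs : Vec X k) → All (λ x → F x ⊆ unions xs) xs
  ⊆unions []       = []
  ⊆unions (x ∷ xs) = p⊆p∪q (unions xs) ∷
    All.map (λ {y} sub {v} p → q⊆p∪q (F x) (unions xs) (sub p)) (⊆unions xs)

  unions⊆ : ∀ {k} {V : Subset n} {xs : Vec X k} → All (λ x → F x ⊆ V) xs → unions xs ⊆ V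
  unions⊆ []               p = contradiction p ∉⊥
  unions⊆ {xs = x ∷ xs} (sub ∷ subs) p = [ sub , unions⊆ subs ]′ (x∈p∪q⁻ (F x) (unions xs) p)

ar≤maxArity : ∀ S R → Signature.ar S R ≤ Signature.maxArity S
ar≤maxArity S R = subst (λ R → ar R ≤ maxArity) (strictlyInverseʳ R)
                        (≤foldr (ar ∘ FinSet.enum Sym) (to R))
  where
  open Signature S
  open Inverse (proj₂ (FinSet.finite Sym))
  ≤foldr : ∀ {n} (f : Fin n → ℕ) i → f i ≤ List.foldr _⊔_ 0 (List.tabulate f)
  ≤foldr f zero    = ℕ.m≤m⊔n (f zero) _
  ≤foldr f (suc i) = ℕ.≤-trans (≤foldr (f ∘ suc) i) (ℕ.m≤n⊔m (f zero) _)

module ToPower {S : Signature} (𝔸 : Structure S) (ℐ : Instance S) {c ℓ} (ℛ : Minion c ℓ) {k m}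
               (maxArity*k≤m : Signature.maxArity S * k ≤ m) (sol : Solution ℛ (lcᵏ 𝔸 ℐ m)) where
  open Signature S
  open Structure 𝔸
  open Instance ℐ
  open Formal using (scope) renaming (sym to symbol)
  open LC (withIdentities (lc 𝔸 ℐ))
  open Minion ℛ
  open Support ℛ

  private
    con : Fin (length constraints) → Formal S (Fin vars)
    con = List.lookup constraints

  support : ⟨ Var ⟩ → Subset vars
  support (inj₁ x) = ⁅ x ⁆
  support (inj₂ j) = unions ⁅_⁆ (scope (con j))

  -- Makes the singleton support of a variable fit the bound: the variable occurs in some scope,
  -- which is therefore nonempty.
  1≤maxArity : Fin vars → 1 ≤ maxArity
  1≤maxArity x = let (R at xs) , x∈xs = ListAny.satisfied (occurs x) in
    ℕ.≤-trans (1≤length x∈xs) (ar≤maxArity S R)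
    where
    1≤length : ∀ {n} {xs : Vec (Fin vars) n} → x ∈ᵛ xs → 1 ≤ n
    1≤length {suc n} _ = s≤s z≤n

  ∣support∣≤ : ∀ v → ∣ support v ∣ ≤ maxArity
  ∣support∣≤ (inj₁ x) = ℕ.≤-trans (ℕ.≤-reflexive (∣⁅x⁆∣≡1 x)) (1≤maxArity x)
  ∣support∣≤ (inj₂ j) =
    ℕ.≤-trans (∣unions∣≤ ⁅_⁆ (ℕ.≤-reflexive ∘ ∣⁅x⁆∣≡1) (scope (con j)))
              (ℕ.≤-trans (ℕ.≤-reflexive (ℕ.*-identityʳ _)) (ar≤maxArity S (symbol (con j))))

  -- Equivalent to `support v ⊆ V`, but in the form that evaluating a partial solution on a scope
  -- consumes.
  Inside : Subset vars → ⟨ Var ⟩ → Set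
  Inside V (inj₁ x) = x ∈ V
  Inside V (inj₂ j) = All (_∈ V) (scope (con j))

  support⊆⇒inside : ∀ {V} v → support v ⊆ V → Inside V v
  support⊆⇒inside (inj₁ x) sub = sub (x∈⁅x⁆ x)
  support⊆⇒inside (inj₂ j) sub = All.map (λ {x} s → sub (s (x∈⁅x⁆ x))) (⊆unions ⁅_⁆ (scope (con j)))

  inside⇒support⊆ : ∀ {V} v → Inside V v → support v ⊆ V
  inside⇒support⊆ {V} (inj₁ x) p q = subst (_∈ V) (sym (x∈⁅y⁆⇒x≡y x q)) p
  inside⇒support⊆ {V} (inj₂ j) ps  =
    unions⊆ ⁅_⁆ (All.map (λ {x} p {y} q → subst (_∈ V) (sym (x∈⁅y⁆⇒x≡y x q)) p) ps)

  inside-act : ∀ {V} c → Inside V (rhs c) → Inside V (lhs c)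
  inside-act (inj₁ (j , i)) ps = lookup⁺ ps i
  inside-act (inj₂ v)       p  = p

  private
    PS : Subset vars → FinSet
    PS = PartialSolution 𝔸 ℐ

  project : ∀ {V} v → Inside V v → ⟨ PS V ⟩ → ⟨ Dom v ⟩
  project {V} (inj₁ x) p  (f , _)     = apply V f p
  project {V} (inj₂ j) ps (f , [ s ]) =
    All.reduce (apply V f) ps , [ ListAll.lookup s (∈-lookup j) ps ]

  project-res : ∀ {V V′} (V⊆V′ : V ⊆ V′) v (p : Inside V v) (p′ : Inside V′ v) f →
                project v p (res 𝔸 ℐ V⊆V′ f) ≡ project v p′ f
  project-res {V} {V′} V⊆V′ (inj₁ x) p p′ (f , _) =
    trans (apply-restrict V⊆V′ f p) (cong (lookup f ∘ index) ([]=-irrelevant (V⊆V′ p) p′))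
  project-res {V} {V′} V⊆V′ (inj₂ j) ps ps′ (f , [ _ ]) = value-injective (reduce-restrict ps ps′)
    where
    reduce-restrict : ∀ {n} {xs : Vec (Fin vars) n} (ps : All (_∈ V) xs) (ps′ : All (_∈ V′) xs) →
      All.reduce (apply V (restrict V⊆V′ f)) ps ≡ All.reduce (apply V′ f) ps′
    reduce-restrict []       []         = refl
    reduce-restrict (p ∷ ps) (p′ ∷ ps′) =
      cong₂ _∷_ (trans (apply-restrict V⊆V′ f p) (cong (lookup f ∘ index) ([]=-irrelevant (V⊆V′ p) p′)))
                (reduce-restrict ps ps′)

  project-act : ∀ {V} c (p : Inside V (rhs c)) f →
                project (lhs c) (inside-act c p) f ≡ act c (project (rhs c) p f)
  project-act {V} (inj₁ (j , i)) ps (f , [ _ ]) = sym (lookup-reduce (apply V f) ps i)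
  project-act     (inj₂ v)       p  f           = refl

  projectAll : ∀ {V n} {vs : Vec ⟨ Var ⟩ n} → All (Inside V) vs → ⟨ PS V ⟩ → ⟨ Πᶠ Dom vs ⟩
  projectAll ps f = All.map (λ {v} p → project v p f) ps

  projectAll-res : ∀ {V V′} (V⊆V′ : V ⊆ V′) {n} {vs : Vec ⟨ Var ⟩ n} (ps : All (Inside V) vs)
                   (ps′ : All (Inside V′) vs) f →
                   projectAll ps (res 𝔸 ℐ V⊆V′ f) ≡ projectAll ps′ f
  projectAll-res V⊆V′ []       []         f = refl
  projectAll-res V⊆V′ (p ∷ ps) (p′ ∷ ps′) f =
    cong₂ _∷_ (project-res V⊆V′ _ p p′ f) (projectAll-res V⊆V′ ps ps′ f)

  module _ {V : Subset vars} where

    insideAll-act : ∀ {n} (cs : Vec ⟨ Con ⟩ n) → All (Inside V) (Vec.map rhs cs) →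
                    All (Inside V) (Vec.map lhs cs)
    insideAll-act cs ps = map⁺ (All.map (λ {c} → inside-act c) (map⁻ ps))

    projectAll-act : ∀ {n} (cs : Vec ⟨ Con ⟩ n) (ps : All (Inside V) (Vec.map rhs cs)) f →
      projectAll (insideAll-act cs ps) f ≡ map⁺ (All.map (λ {c} → act c) (map⁻ (projectAll ps f)))
    projectAll-act []       []       f = refl
    projectAll-act (c ∷ cs) (p ∷ ps) f = cong₂ _∷_ (project-act c p f) (projectAll-act cs ps f)

    insideAll-pick : ∀ {n m} {vs : Vec ⟨ Var ⟩ n} (σ : Vec (Fin n) m) → All (Inside V) vs →
                     All (Inside V) (Vec.map (lookup vs) σ)
    insideAll-pick σ ps = map⁺ (All.universal (lookup⁺ ps) σ)

    lookup-projectAll : ∀ {n} {vs : Vec ⟨ Var ⟩ n} (ps : All (Inside V) vs) f i →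
                        project (lookup vs i) (lookup⁺ ps i) f ≡ lookup⁺ (projectAll ps f) i
    lookup-projectAll (p ∷ ps) f zero    = refl
    lookup-projectAll (p ∷ ps) f (suc i) = lookup-projectAll ps f i

    projectAll-pick : ∀ {n m} {vs : Vec ⟨ Var ⟩ n} (σ : Vec (Fin n) m) (ps : All (Inside V) vs) f →
      projectAll (insideAll-pick σ ps) f ≡ map⁺ (All.universal (lookup⁺ (projectAll ps f)) σ)
    projectAll-pick []      ps f = refl
    projectAll-pick (i ∷ σ) ps f = cong₂ _∷_ (lookup-projectAll ps f i) (projectAll-pick σ ps f)

  ⋃ : Vec ⟨ Var ⟩ k → Subset vars
  ⋃ = unions support

  inside-⋃ : ∀ vs → All (Inside (⋃ vs)) vs
  inside-⋃ vs = All.map (λ {v} → support⊆⇒inside v) (⊆unions support vs)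

  ⋃⊆ : ∀ {V vs} → All (Inside V) vs → ⋃ vs ⊆ V
  ⋃⊆ ps = unions⊆ support (All.map (λ {v} p {x} → inside⇒support⊆ v p {x}) ps)

  private
    small : Vec ⟨ Var ⟩ k → ⟨ LC.Var (lcᵏ 𝔸 ℐ m) ⟩
    small vs = ⋃ vs , [ ℕ.≤-trans (∣unions∣≤ support ∣support∣≤ vs)
                       (ℕ.≤-trans (ℕ.≤-reflexive (ℕ.*-comm k maxArity)) maxArity*k≤m) ]

    small-edge : ∀ {ws vs} → ⋃ ws ⊆ ⋃ vs → Edge (lcᵏ 𝔸 ℐ m) (small ws) (small vs)
    small-edge {ws} {vs} sub = edge ((small ws , small vs) , [ sub ])

    act-step : ∀ (cs : Vec ⟨ Con ⟩ k) (f : ⟨ PS (⋃ (Vec.map rhs cs)) ⟩) →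
      projectAll (inside-⋃ (Vec.map lhs cs))
        (res 𝔸 ℐ (⋃⊆ (insideAll-act cs (inside-⋃ (Vec.map rhs cs)))) f) ≡
      map⁺ (All.map (λ {c} → act c) (map⁻ (projectAll (inside-⋃ (Vec.map rhs cs)) f)))
    act-step cs f = trans
      (projectAll-res (⋃⊆ (insideAll-act cs (inside-⋃ (Vec.map rhs cs)))) _ _ f)
      (projectAll-act cs (inside-⋃ (Vec.map rhs cs)) f)

    pick-step : ∀ (vs : Vec ⟨ Var ⟩ k) (σ : Vec (Fin k) k) (f : ⟨ PS (⋃ vs) ⟩) →
      projectAll (inside-⋃ (Vec.map (lookup vs) σ))
        (res 𝔸 ℐ (⋃⊆ (insideAll-pick σ (inside-⋃ vs))) f) ≡
      map⁺ (All.universal (lookup⁺ (projectAll (inside-⋃ vs) f)) σ)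
    pick-step vs σ f = trans
      (projectAll-res (⋃⊆ (insideAll-pick σ (inside-⋃ vs))) _ _ f)
      (projectAll-pick σ (inside-⋃ vs) f)

    module Pow = LC (pow k (lc 𝔸 ℐ))

    -- In both kinds of constraints the left tuple involves only variables of `ℐ` that the right
    -- tuple already involves. Each therefore lies over one inclusion constraint, and evaluation
    -- commutes with restriction.
    step : ∀ c → Σ[ e ∈ Edge (lcᵏ 𝔸 ℐ m) (small (Pow.lhs c)) (small (Pow.rhs c)) ]
      (∀ f → projectAll (inside-⋃ (Pow.lhs c)) (along e f) ≡
             Pow.act c (projectAll (inside-⋃ (Pow.rhs c)) f))
    step (inj₁ cs)       =
      small-edge {Vec.map lhs cs} {Vec.map rhs cs}
                 (⋃⊆ (insideAll-act cs (inside-⋃ (Vec.map rhs cs)))) , act-step cs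
    step (inj₂ (vs , σ)) =
      small-edge {Vec.map (lookup vs) σ} {vs} (⋃⊆ (insideAll-pick σ (inside-⋃ vs))) , pick-step vs σ

  solution : Solution ℛ (pow k (lc 𝔸 ℐ))
  solution = transfer {lcᵏ 𝔸 ℐ m} {pow k (lc 𝔸 ℐ)} sol small
    (λ vs → projectAll (inside-⋃ vs)) step

-- From the saturated power to lcᵏ

-- A placement of `U` into `k` slots. As `∣ U ∣` may be smaller than `k`, surplus slots hold
-- `nothing`.
record Cover {n} (U : Subset n) (k : ℕ) : Set where
  field
    entry     : Fin k → Maybe (∃[ x ] x ∈ U)
    pos       : ∀ {x} → x ∈ U → Fin k
    entry-pos : ∀ {x} (p : x ∈ U) → entry (pos p) ≡ just (x , p)

partialInverse : ∀ {m k} → m ≤ k → Σ[ f ∈ (Fin m → Fin k) ] Σ[ g ∈ (Fin k → Maybe (Fin m)) ]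
                 (∀ i → g (f i) ≡ just i)
partialInverse z≤n       = (λ ()) , const nothing , λ ()
partialInverse (s≤s m≤k) =
  let f , g , g∘f = partialInverse m≤k in
    (λ { zero → zero ; (suc i) → suc (f i) })
  , (λ { zero → just zero ; (suc j) → Maybe.map suc (g j) })
  , (λ { zero → refl ; (suc i) → cong (Maybe.map suc) (g∘f i) })

cover : ∀ {n k} (U : Subset n) → ∣ U ∣ ≤ k → Cover U k
cover U ∣U∣≤k = let f , g , g∘f = partialInverse ∣U∣≤k in record
  { entry     = Maybe.map (element U) ∘ g
  ; pos       = f ∘ index
  ; entry-pos = λ p → trans (cong (Maybe.map (element U)) (g∘f (index p)))
                            (cong just (element-index p))
  }

module FromPower {S : Signature} (𝔸 : Structure S) (ℐ : Instance S)
                 {c ℓ} (ℛ : Minion c ℓ)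
                 (nontrivial : ¬ (∀ 𝒟 → NonemptyDomains 𝒟 → Solution ℛ 𝒟))
                 {k} (sol : Solution ℛ (pow (suc k) (lc 𝔸 ℐ)))
                 (j₀ : Fin (length (Instance.constraints ℐ))) where
  open Signature S
  open Structure 𝔸
  open Instance ℐ
  open Formal using (scope) renaming (sym to symbol)
  open LC (lc 𝔸 ℐ) using (Var; Dom)
  open Tuples (lc 𝔸 ℐ)
  open Minion ℛ
  open Support ℛ
  open Cover

  private
    con : Fin (length constraints) → Formal S (Fin vars)
    con = List.lookup constraints

    -- Fills both the surplus slots of a cover and the spare slot in front; any constraint would do.
    y₀ : ⟨ Var ⟩
    y₀ = inj₂ j₀

  decode : ∀ {U : Subset vars} → Maybe (∃[ x ] x ∈ U) → ⟨ Var ⟩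
  decode nothing        = y₀
  decode (just (x , _)) = inj₁ x

  body : ∀ {U} → Cover U k → Fin k → ⟨ Var ⟩
  body C = decode ∘ entry C

  -- The slot in front stays free, to be overwritten by one more variable.
  tuple : ∀ {U} → Cover U k → Fin (suc k) → ⟨ Var ⟩
  tuple C = y₀ Vector.∷ body C

  Assignment : Subset vars → FinSet
  Assignment U = Univ ^ᶠ ∣ U ∣

  module _ {U : Subset vars} (C : Cover U k) where

    get : ∀ {x} → x ∈ U → Values (body C) → ⟨ Univ ⟩
    get p d = subst (⟨_⟩ ∘ Dom ∘ decode) (entry-pos C p) (d (pos C p))

    assign : Values (body C) → ⟨ Assignment U ⟩
    assign d = tabulate λ i → get (proj₂ (element U i)) d

    apply-assign : ∀ d {x} (p : x ∈ U) → apply U (assign d) p ≡ get p d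
    apply-assign d p = trans (lookup∘tabulate _ (index p))
                             (cong (λ (_ , q) → get q d) (element-index p))

    assign-ext : ∀ {d d′ : Values (body C)} → (∀ i → d i ≡ d′ i) → assign d ≡ assign d′
    assign-ext d≗d′ = tabulate-cong λ i →
      cong (subst _ (entry-pos C (proj₂ (element U i)))) (d≗d′ _)

    local : ∣ Assignment U ∣ᴹ
    local = push ℛ sol (Assignment U) (tuple C) (λ d → assign (dropZero {y = y₀} d))

  module _ {U U′ : Subset vars} (U⊆U′ : U ⊆ U′) (C : Cover U k) (C′ : Cover U′ k) where

    private
      decodeRead : (m : Maybe (∃[ x ] x ∈ U)) → Read (tuple C′) (decode m)
      -- A surplus slot holds `y₀`, which the front slot of `tuple C′` is sure to contain even if
      -- `C′` has no surplus slot.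
      decodeRead nothing        = position zero
      decodeRead (just (x , p)) =
        subst (Read (tuple C′)) (cong decode (entry-pos C′ (U⊆U′ p))) (position (suc (pos C′ (U⊆U′ p))))

      κ : ∀ j → Read (tuple C′) (tuple C j)
      κ zero    = position zero
      κ (suc j) = decodeRead (entry C j)

      get-κ : ∀ d {x} (p : x ∈ U) →
              get C p (λ j → read (κ (suc j)) d) ≡ get C′ (U⊆U′ p) (dropZero {y = y₀} d)
      get-κ d p = trans (dcong {B = ⟨_⟩ ∘ Dom ∘ decode} (λ m → read (decodeRead m) d) (entry-pos C p))
                 (trans (read-subst (cong decode (entry-pos C′ (U⊆U′ p))) (position _) d)
                        (sym (subst-∘ (entry-pos C′ (U⊆U′ p)))))

      assign-κ : ∀ d → assign C (λ j → read (κ (suc j)) d) ≡ restrict U⊆U′ (assign C′ (dropZero {y = y₀} d))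
      assign-κ d = tabulate-cong λ i → let p = proj₂ (element U i) in
        trans (get-κ d p) (trans (sym (apply-assign C′ (dropZero {y = y₀} d) (U⊆U′ p)))
          (cong (lookup (assign C′ (dropZero {y = y₀} d)) ∘ index)
            ([]=-irrelevant (U⊆U′ p) (recompute (_ ∈? U′) (U⊆U′ p)))))

    -- Every entry of `tuple C` also occurs in `tuple C′`, so `push-read` applies. The covers are
    -- unrelated, hence so may be the choices of slots for `U` and `U′`.
    local-restrict : _≈_ {Assignment U} (local C)
                         (map {Assignment U′} {Assignment U} (restrict U⊆U′) (local C′))
    local-restrict = push-read ℛ sol {Assignment U′} {Assignment U} {tuple C′} {tuple C} κ
      (λ d → assign C (dropZero {y = y₀} d)) (λ d≗d′ → assign-ext C (d≗d′ ∘ suc))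
      (restrict U⊆U′) (λ d → assign C′ (dropZero {y = y₀} d)) assign-κ

  module _ {U : Subset vars} (C : Cover U k) (j : Fin (length constraints))
           (ps : All (_∈ U) (scope (con j))) (i₀ : Fin (ar (symbol (con j)))) where

    private
      mem : ∀ i → lookup (scope (con j)) i ∈ U
      mem = lookup⁺ ps

      P : Fin k
      P = pos C (mem i₀)

      -- The constraint takes the slot of its `i₀`-th variable, so the front slot remains spare for
      -- comparisons.
      z : Fin k → ⟨ Var ⟩
      z = Vector.updateAt (body C) P (const (inj₂ j))

      z-P : z P ≡ inj₂ j
      z-P = updateAt-updates P (body C)

      κ : ∀ i → Read z (body C i)
      κ i with i Fin.≟ P
      -- The displaced variable is recovered as the `i₀`-th projection of the constraint that
      -- replaced it.
      ... | yes refl = P , subst₂ Link (sym (cong decode (entry-pos C (mem i₀)))) (sym z-P)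
                                  (edge (inj₁ (j , i₀)))
      ... | no  i≢P  = subst (Read z) (updateAt-minimal i P (body C) i≢P) (position i)

      Q : FinSet
      Q = Assignment U ×ᶠ Dom (inj₂ j)

      g : Values z → ⟨ Q ⟩
      g d = assign C (λ i → read (κ i) d) , subst (⟨_⟩ ∘ Dom) z-P (d P)

      g-ext : ∀ {d d′ : Values z} → (∀ i → d i ≡ d′ i) → g d ≡ g d′
      g-ext {d} {d′} d≗d′ = cong₂ _,_
        (assign-ext C λ i → cong (along (proj₂ (κ i))) (d≗d′ (proj₁ (κ i))))
        (cong (subst (⟨_⟩ ∘ Dom) z-P) (d≗d′ P))

      q : ∣ Q ∣ᴹ
      q = push ℛ sol Q (y₀ Vector.∷ z) (λ d → g (dropZero {y = y₀} d))

      κ⁺ : ∀ i → Read (y₀ Vector.∷ z) (tuple C i)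
      κ⁺ zero    = position zero
      κ⁺ (suc i) = weaken {y = y₀} (κ i)

      -- `q` refines `local C` by a tuple of the relation, so supports found for `q` descend along
      -- `proj₁`.
      local-q : _≈_ {Assignment U} (local C) (map {Q} {Assignment U} proj₁ q)
      local-q = push-read ℛ sol {Q} {Assignment U} {y₀ Vector.∷ z} {tuple C} κ⁺
        (λ d → assign C (dropZero {y = y₀} d)) (λ d≗d′ → assign-ext C (d≗d′ ∘ suc))
        proj₁ (λ d → g (dropZero {y = y₀} d)) (λ _ → refl)

      α β : Fin (ar (symbol (con j))) → ⟨ Q ⟩ → ⟨ Univ ⟩
      α i (f , t) = lookup (value t) i
      β i (f , t) = apply U f (mem i)

      module _ (i : Fin (ar (symbol (con j)))) where

        -- Two ways to read the `i`-th scope variable. If it is the displaced one, the second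
        -- reading is the `i₀`-th coordinate of the constraint, so repetitions in the scope are
        -- compared as well.
        fromConstraint fromTuple : Read z (inj₁ (lookup (scope (con j)) i))
        fromConstraint = P , subst (Link _) (sym z-P) (edge (inj₁ (j , i)))
        fromTuple = subst (Read z) (cong decode (entry-pos C (mem i))) (κ (pos C (mem i)))

        along-subst : ∀ {y} (y≡ : y ≡ inj₂ j) (v : ⟨ Dom y ⟩) →
          along (subst (Link (inj₁ (lookup (scope (con j)) i))) (sym y≡) (edge (inj₁ (j , i)))) v ≡
          lookup (value (subst (⟨_⟩ ∘ Dom) y≡ v)) i
        along-subst refl v = refl

        fromTuple-β : ∀ d → read fromTuple d ≡ β i (g d)
        fromTuple-β d =
          trans (read-subst (cong decode (entry-pos C (mem i))) (κ (pos C (mem i))) d)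
         (trans (sym (subst-∘ (entry-pos C (mem i))))
                (sym (apply-assign C (λ i → read (κ i) d) (mem i))))

        supported-q : Supported Q (λ e → α i e ≡ β i e) q
        supported-q = supported-reads ℛ sol {Q} {y₀} {inj₁ (lookup (scope (con j)) i)} {z}
          fromConstraint fromTuple g g-ext (α i) (β i) (λ d → along-subst z-P (d P)) fromTuple-β

      consistent : ∀ {e} → (∀ i → α i e ≡ β i e) →
                   Rel (symbol (con j)) (All.reduce (apply U (proj₁ e)) ps)
      consistent {f , (t , [ r ])} α≗β = subst (Rel _)
        (lookup-ext λ i → trans (α≗β i) (sym (lookup-reduce (apply U f) ps i)))
        (recompute (Rel? _ t) r)

    -- Intersecting the supports of `q` over all coordinates leaves the pairs whose assignment,
    -- restricted to the scope, is the accompanying tuple. That tuple lies in the relation.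
    supported-constraint⁺ :
      Supported (Assignment U) (λ f → Rel (symbol (con j)) (All.reduce (apply U f) ps)) (local C)
    supported-constraint⁺ = supported-resp (Setoid.sym (obj (Assignment U)) local-q)
      (supported-map {E = Assignment U} proj₁ (λ {e} → consistent {e})
        (supported-⋂ _ (λ i e → ≡-finite Univ (α i e) (β i e)) supported-q))

  -- The value at the constant tuple yields an element over the domain of the constraint. Its full
  -- support must be inhabited.
  relation-nonempty : ∀ j → ∃ (Rel (symbol (con j)))
  relation-nonempty j with supported⇒∃ nontrivial (λ _ → yes _)
    (supported-all {Dom (inj₂ j)}
      {push ℛ sol (Dom (inj₂ j)) (const (inj₂ j)) (λ d → d zero)} {λ _ → ⊤} (λ _ → _))
  ... | (t , [ r ]) , _ = t , recompute (Rel? _ t) r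

  supported-constraint : ∀ {U} (C : Cover U k) j (ps : All (_∈ U) (scope (con j))) →
    Supported (Assignment U) (λ f → Rel (symbol (con j)) (All.reduce (apply U f) ps)) (local C)
  supported-constraint {U} C j ps with ∃? (FinType (ar (symbol (con j)))) {λ _ → ⊤} (λ _ → yes _)
  ... | yes (i₀ , _) = supported-constraint⁺ C j ps i₀
  -- With an empty scope there is no variable to displace, but the relation is nonempty and its only
  -- possible member is the empty tuple.
  ... | no  nullary  = supported-all λ f →
    let t , r = relation-nonempty j in
    subst (Rel _) (lookup-ext λ i → contradiction (i , _) nullary) r

  Satisfied : (U : Subset vars) → Fin (length constraints) → Pred ⟨ Assignment U ⟩ 0ℓ
  Satisfied U j f = (ps : All (_∈ U) (scope (con j))) → Rel (symbol (con j)) (All.reduce (apply U f) ps)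

  satisfied : ∀ {U} j (ps : All (_∈ U) (scope (con j))) {f} →
              Rel (symbol (con j)) (All.reduce (apply U f) ps) → Satisfied U j f
  satisfied {U} j ps {f} r qs =
    subst (λ ps → Rel (symbol (con j)) (All.reduce (apply U f) ps)) (All.irrelevant []=-irrelevant ps qs) r

  satisfied? : ∀ U j → Decidable (Satisfied U j)
  satisfied? U j f with All.all? (_∈? U) (scope (con j))
  ... | no ¬ps = yes λ ps → contradiction ps ¬ps
  ... | yes ps = map′ (satisfied j ps {f}) (λ h → h ps) (Rel? _ _)

  supported-satisfied : ∀ {U} (C : Cover U k) j → Supported (Assignment U) (Satisfied U j) (local C)
  supported-satisfied {U} C j with All.all? (_∈? U) (scope (con j))
  ... | no ¬ps = supported-all λ f ps → contradiction ps ¬ps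
  ... | yes ps = λ E f g f≗g → supported-constraint C j ps E f g (λ {h} r → f≗g {h} (satisfied j ps {h} r))

  -- Intersects over the finitely many constraints; those whose scope is not inside `U` hold
  -- vacuously.
  supported-partial : ∀ {U} (C : Cover U k) →
                      Supported (Assignment U) (IsPartialSolution 𝔸 ℐ U) (local C)
  supported-partial {U} C E f g f≗g =
    supported-⋂ _ (satisfied? U) (supported-satisfied C) E f g (λ {h} s → f≗g {h} (all-lookup⁻ constraints s))

  private
    -- That `U` has a partial solution at all, as the retraction requires, follows from
    -- `supported⇒∃`.
    module R {U} (C : Cover U k) =
      Retraction {Assignment U} (isPartialSolution? 𝔸 ℐ U)
                 (supported⇒∃ nontrivial (isPartialSolution? 𝔸 ℐ U) (supported-partial C))

    coverOf : (U : ⟨ LC.Var (lcᵏ 𝔸 ℐ k) ⟩) → Cover (value U) k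
    coverOf (U , [ ∣U∣≤k ]) = cover U (recompute (∣ U ∣ ≤? k) ∣U∣≤k)

  -- Retraction need not commute with restriction at assignments sent to the default. On partial
  -- solutions both retractions change nothing, and these support `local`.
  solution : Solution ℛ (lcᵏ 𝔸 ℐ k)
  solution = solve (lcᵏ 𝔸 ℐ k) (Assignment ∘ value) (local ∘ coverOf)
    (IsPartialSolution 𝔸 ℐ ∘ value) (supported-partial ∘ coverOf)
    (R.retract ∘ coverOf)
    λ { ((U , U′) , [ sub ]) →
        let U⊆U′ = recompute (value U ⊆? value U′) sub
            C    = coverOf U
            C′   = coverOf U′
        in restrict U⊆U′
         , local-restrict U⊆U′ C C′
         , λ {f} s → trans (R.retract-∈ C _ (restrict-isPartialSolution 𝔸 ℐ U⊆U′ {f} s))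
                           (cong (res 𝔸 ℐ U⊆U′) (sym (R.retract-∈ C′ f s))) }

-- Instances without constraints, and the two implications

module _ {S : Signature} (𝔸 : Structure S) (ℐ : Instance S) {c ℓ} (ℛ : Minion c ℓ) where
  open Instance ℐ
  open Minion ℛ
  open Support ℛ

  -- Every variable occurs in a constraint, so here there are none. A positive power then has no
  -- variables and its solution contains no element, whereas the empty set is a variable of `lcᵏ`;
  -- its value must come from `Inhabited`.
  solution-unconstrained : constraints ≡ [] → Inhabited ℛ → ∀ k → Solution ℛ (lcᵏ 𝔸 ℐ k)
  solution-unconstrained none (D , r) k =
    solve (lcᵏ 𝔸 ℐ k) (const D) (const r) (λ _ _ → ⊤) (λ _ → supported-all λ _ → _)
      (λ U _ → empty (value U))
      λ { ((U , _) , [ _ ]) →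
            id , Setoid.sym (obj D) (map-id {D} r) ,
            λ _ → value-injective (lookup-ext λ i → contradiction (proj₁ (element (value U) i)) no-vars) }
    where
    no-vars : ¬ Fin vars
    no-vars x with subst (ListAny.Any _) none (occurs x)
    ... | ()

    empty : ∀ U → ⟨ PartialSolution 𝔸 ℐ U ⟩
    empty U = tabulate (λ i → contradiction (proj₁ (element U i)) no-vars)
            , [ subst (ListAll.All _) (sym none) ListAll.[] ]

empty-or-index : ∀ {X : Set} (xs : List X) → xs ≡ [] ⊎ Fin (length xs)
empty-or-index []      = inj₁ refl
empty-or-index (_ ∷ _) = inj₂ zero

module _ {S : Signature} (𝔸 : Structure S) (ℐ : Instance S) {c ℓ} (ℛ : Minion c ℓ) (k : ℕ) where

  power-from-partial : Solution ℛ (lcᵏ 𝔸 ℐ (Signature.maxArity S * k)) → Solution ℛ (pow k (lc 𝔸 ℐ))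
  power-from-partial = ToPower.solution 𝔸 ℐ ℛ ℕ.≤-refl

  partial-from-power : ¬ (∀ 𝒟 → NonemptyDomains 𝒟 → Solution ℛ 𝒟) →
                       (Instance.constraints ℐ ≡ [] → Inhabited ℛ) →
                       Solution ℛ (pow (suc k) (lc 𝔸 ℐ)) → Solution ℛ (lcᵏ 𝔸 ℐ k)
  partial-from-power nontrivial inhabited sol with empty-or-index (Instance.constraints ℐ)
  ... | inj₁ none = solution-unconstrained 𝔸 ℐ ℛ none (inhabited none) k
  ... | inj₂ j₀   = FromPower.solution 𝔸 ℐ ℛ nontrivial sol j₀

theorem6p7 : ∀ {c ℓ} (S : Signature) (𝒯 : Template S) (ℛ : Minion c ℓ) →
    ¬ (∀ 𝒟 → Solution ℛ 𝒟) →
    (ℐ : Instance S) (k : ℕ) →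
    let open Template 𝒯 using (𝔸) in
    (Solution ℛ (lcᵏ 𝔸 ℐ (Signature.maxArity S * k)) →
    Solution ℛ (pow k (lc 𝔸 ℐ)))
    ×
    (¬ (∀ 𝒟 → NonemptyDomains 𝒟 → Solution ℛ 𝒟) →
    (Instance.constraints ℐ ≡ [] → Inhabited ℛ) →
    Solution ℛ (pow (suc k) (lc 𝔸 ℐ)) →
    Solution ℛ (lcᵏ 𝔸 ℐ k))
-- The transfers along identities replace conversions between Solution types,
-- in which Agda would unfold all finiteness proofs.
theorem6p7 S 𝒯 ℛ _ ℐ k =
    (λ sol → transfer (power-from-partial 𝔸 ℐ ℛ k
                         (transfer sol id (λ _ → id) λ c → edge c , λ _ → refl))
                      id (λ _ → id) λ c → edge c , λ _ → refl)
  , (λ nontrivial inhabited sol →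
       transfer (partial-from-power 𝔸 ℐ ℛ k nontrivial inhabited
                   (transfer sol id (λ _ → id) λ c → edge c , λ _ → refl))
                id (λ _ → id) λ c → edge c , λ _ → refl)
  where
  open Template 𝒯 using (𝔸)
  open Support ℛ using (transfer)
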